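{- Let $G=(V,E)$ be a finite Eulerian graph (every vertex has even degree; $G$ need not be connected). For $A\subseteq E$ let $\varepsilon(A)$ denote the number of Eulerian orientations of the graph $(V,A)$ and let $h(A)$ denote the number of half graphs of $(V,A)$. Then $$\varepsilon(G)^2=\sum_{A\subseteq E}\varepsilon(A)\,\varepsilon(E\setminus A)\qquad\text{and}\qquad h(G)^2=\sum_{A\subseteq E}h(A)\,h(E\setminus A),$$ where $\varepsilon(G)=\varepsilon(E)$ and $h(G)=h(E)$.
   Context: An Eulerian orientation of a graph is an orientation of its edges in which every vertex has in-degree equal to its out-degree. A half graph of a graph $F=(V,A)$ is a subset $S\subseteq A$ of edges such that for every vertex $v$ the number of edges of $S$ incident to $v$ equals $d_F(v)/2$, where $d_F(v)$ is the degree of $v$ in $F$. (If some vertex has odd degree in $(V,A)$, then $\varepsilon(A)=h(A)=0$.) -}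

module Defs where

open import Data.Bool using (true; false)
open import Data.Fin using (Fin; _≟_)
open import Data.Fin.Properties using (all?)
open import Data.Fin.Subset using (Subset)
open import Data.List using (List; []; _∷_; length; filter; map; cartesianProductWith)
open import Data.Nat using (ℕ; zero; suc; _*_)
import Data.Nat as ℕ
open import Data.Nat.ListAction using (sum)
open import Data.Nat.Divisibility using (_∣_)
open import Data.Product using (_×_; _,_; proj₁; proj₂)
open import Data.Sum using (_⊎_)
open import Data.Vec using ([]; _∷_)
open import Relation.Binary.PropositionalEquality using (_≡_; _≢_)
open import Relation.Nullary using (Dec)
open import Relation.Nullary.Decidable using (_⊎-dec_)

-- The order of the two endpoints carries no meaning: every notion below is
-- symmetric in end₁ and end₂.
record Edge (n : ℕ) : Set where
  field
    end₁ end₂ : Fin n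
    loopless  : end₁ ≢ end₂

open Edge public

-- A finite graph on the vertex set Fin n, given by its edges.  An edge is
-- identified by its position in the list, so parallel edges are allowed and
-- are distinct; the edge set E is Fin (length G).
Graph : ℕ → Set
Graph n = List (Edge n)

EdgeSet : ∀ {n} → Graph n → Set
EdgeSet G = Subset (length G)

-- G ↾ A is the spanning subgraph (V , A): all vertices are kept.
infixl 8 _↾_
_↾_ : ∀ {n} (G : Graph n) → EdgeSet G → Graph n
[]      ↾ []          = []
(e ∷ G) ↾ (true  ∷ A) = e ∷ (G ↾ A)
(e ∷ G) ↾ (false ∷ A) = G ↾ A

subsets : (m : ℕ) → List (Subset m)
subsets zero    = [] ∷ []
subsets (suc m) = cartesianProductWith _∷_ (true ∷ false ∷ []) (subsets m)

edgeSets : ∀ {n} (G : Graph n) → List (EdgeSet G)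
edgeSets G = subsets (length G)

Incident : ∀ {n} → Fin n → Edge n → Set
Incident v e = v ≡ end₁ e ⊎ v ≡ end₂ e

incident? : ∀ {n} (v : Fin n) (e : Edge n) → Dec (Incident v e)
incident? v e = (v ≟ end₁ e) ⊎-dec (v ≟ end₂ e)

degree : ∀ {n} → Graph n → Fin n → ℕ
degree G v = length (filter (incident? v) G)

IsEulerianGraph : ∀ {n} → Graph n → Set
IsEulerianGraph G = ∀ v → 2 ∣ degree G v

-- (tail , head)
Arc : ℕ → Set
Arc n = Fin n × Fin n

tail head : ∀ {n} → Arc n → Fin n
tail = proj₁
head = proj₂

-- The two arcs are distinct because edges are loopless.
arcsOf : ∀ {n} → Edge n → List (Arc n)
arcsOf e = (end₁ e , end₂ e) ∷ (end₂ e , end₁ e) ∷ []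

-- An orientation of G is a list of arcs, the i-th one orienting the i-th edge.
orientations : ∀ {n} → Graph n → List (List (Arc n))
orientations []      = [] ∷ []
orientations (e ∷ G) = cartesianProductWith _∷_ (arcsOf e) (orientations G)

inDegree outDegree : ∀ {n} → List (Arc n) → Fin n → ℕ
inDegree  o v = length (filter (λ a → v ≟ head a) o)
outDegree o v = length (filter (λ a → v ≟ tail a) o)

IsEulerianOrientation : ∀ {n} → List (Arc n) → Set
IsEulerianOrientation o = ∀ v → inDegree o v ≡ outDegree o v

isEulerianOrientation? : ∀ {n} (o : List (Arc n)) → Dec (IsEulerianOrientation o)
isEulerianOrientation? o = all? (λ v → inDegree o v ℕ.≟ outDegree o v)

ε : ∀ {n} → Graph n → ℕ
ε G = length (filter isEulerianOrientation? (orientations G))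

-- The condition d_S(v) = d_G(v)/2 is cleared of its denominator, so that it
-- is unsatisfiable when d_G(v) is odd (ℕ division would round down).
IsHalfGraph : ∀ {n} (G : Graph n) → EdgeSet G → Set
IsHalfGraph G S = ∀ v → 2 * degree (G ↾ S) v ≡ degree G v

isHalfGraph? : ∀ {n} (G : Graph n) (S : EdgeSet G) → Dec (IsHalfGraph G S)
isHalfGraph? G S = all? (λ v → 2 * degree (G ↾ S) v ℕ.≟ degree G v)

h : ∀ {n} → Graph n → ℕ
h G = length (filter (isHalfGraph? G) (edgeSets G))

∑⊆ : ∀ {n} (G : Graph n) → (EdgeSet G → ℕ) → ℕ
∑⊆ G f = sum (map f (edgeSets G))

{-# OPTIONS --safe #-}

-- Both ε(G) and h(G) count signings s of the edges with ∑ s(e) w(e) = 0, where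
-- w(e) is the difference of the indicators of the two ends of e in the first
-- case and their sum in the second.  For balanced signings s and t, let A be
-- the set of edges where they agree.  The parts p and q of ∑ s(e) w(e) on A and
-- on E ∖ A satisfy p + q = 0 (from s) and p − q = 0 (from t), so p = q = 0.
-- Hence (s , t) ↦ (A , s|A , s|E∖A) is a bijection onto the triples counted on
-- the right-hand side.
module Submission where

open import Data.Fin.Subset using (∁)
open import Data.Nat using (ℕ; _*_; _^_)
open import Data.Product using (_×_)
open import Relation.Binary.PropositionalEquality using (_≡_)
open import Defs

open import Data.Bool using (true; false; if_then_else_)
open import Data.Fin using (Fin; _≟_)
open import Data.Fin.Properties using (all?)
open import Data.Integer as ℤ using (ℤ; 0ℤ; +_)
import Data.Integer.Properties as ℤ
import Data.Integer.Tactic.RingSolver as ℤ-Solver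
open import Data.List using (List; []; _∷_; _++_; length; filter; map; cartesianProductWith)
open import Data.List.Properties using (filter-++; length-++; map-++; map-∘; ++-identityʳ)
open import Data.Nat using (_+_; suc)
open import Data.Nat.ListAction using (sum)
open import Data.Nat.ListAction.Properties using (sum-++)
open import Data.Nat.Properties using (*-distribʳ-+; *-distribˡ-+; *-identityʳ; +-identityʳ)
import Data.Nat.Tactic.RingSolver as ℕ-Solver
open import Data.Product using (_,_)
open import Data.Sum using (inj₂)
open import Data.Vec using ([]; _∷_)
open import Function using (_∘_; _⇔_; mk⇔)
open import Function.Construct.Composition using (_⇔-∘_)
open import Level using (Level; 0ℓ)
open import Relation.Binary.PropositionalEquality using (refl; sym; trans; cong; cong₂; module ≡-Reasoning)
open import Relation.Nullary using (Dec; does)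
open import Relation.Nullary.Decidable using (_×-dec_; does-⇔)
open import Relation.Unary using (Pred; Decidable)

open ≡-Reasoning

private
  variable
    a p : Level
    A B C : Set a
    P Q : Set p
    n : ℕ

-- Indicators, counting by filtering, and sums over edge sets.

indicator : Dec P → ℕ
indicator P? = if does P? then 1 else 0

indicator-cong : P ⇔ Q → (P? : Dec P) (Q? : Dec Q) → indicator P? ≡ indicator Q?
indicator-cong P⇔Q P? Q? = cong (if_then 1 else 0) (does-⇔ P⇔Q P? Q?)

indicator-× : (P? : Dec P) (Q? : Dec Q) → indicator P? * indicator Q? ≡ indicator (P? ×-dec Q?)
indicator-× P? Q? with does P?
... | true  = +-identityʳ (indicator Q?)
... | false = refl

cartesianProductWith-pair : (f : A → B → C) (x y : A) (zs : List B) →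
  cartesianProductWith f (x ∷ y ∷ []) zs ≡ map (f x) zs ++ map (f y) zs
cartesianProductWith-pair f x y zs = cong (map (f x) zs ++_) (++-identityʳ (map (f y) zs))

length-filter-∷ : {P : Pred A p} (P? : Decidable P) (x : A) (xs : List A) →
  length (filter P? (x ∷ xs)) ≡ indicator (P? x) + length (filter P? xs)
length-filter-∷ P? x xs with does (P? x)
... | true  = refl
... | false = refl

length-filter-map : {P : Pred B p} (P? : Decidable P) (f : A → B) (xs : List A) →
  length (filter P? (map f xs)) ≡ length (filter (P? ∘ f) xs)
length-filter-map P? f []       = refl
length-filter-map P? f (x ∷ xs) with does (P? (f x))
... | true  = cong suc (length-filter-map P? f xs)
... | false = length-filter-map P? f xs

sum-map-cong : {f g : A → ℕ} → (∀ x → f x ≡ g x) → (xs : List A) → sum (map f xs) ≡ sum (map g xs)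
sum-map-cong f≗g []       = refl
sum-map-cong f≗g (x ∷ xs) = cong₂ _+_ (f≗g x) (sum-map-cong f≗g xs)

sum-map-+ : (f g : A → ℕ) (xs : List A) →
  sum (map (λ x → f x + g x) xs) ≡ sum (map f xs) + sum (map g xs)
sum-map-+ f g []       = refl
sum-map-+ f g (x ∷ xs) = begin
  f x + g x + sum (map (λ y → f y + g y) xs)    ≡⟨ cong (λ s → f x + g x + s) (sum-map-+ f g xs) ⟩
  f x + g x + (sum (map f xs) + sum (map g xs)) ≡⟨ interchange (f x) (g x) _ _ ⟩
  f x + sum (map f xs) + (g x + sum (map g xs)) ∎
  where
  interchange : ∀ i j k l → i + j + (k + l) ≡ i + k + (j + l)
  interchange = ℕ-Solver.solve-∀

∑⊆-∷ : (e : Edge n) (G : Graph n) (f : EdgeSet (e ∷ G) → ℕ) →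
  ∑⊆ (e ∷ G) f ≡ ∑⊆ G (f ∘ (true ∷_)) + ∑⊆ G (f ∘ (false ∷_))
∑⊆-∷ e G f = begin
  ∑⊆ (e ∷ G) f
    ≡⟨ cong (sum ∘ map f) (cartesianProductWith-pair _∷_ true false As) ⟩
  sum (map f (map (true ∷_) As ++ map (false ∷_) As))
    ≡⟨ cong sum (map-++ f (map (true ∷_) As) _) ⟩
  sum (map f (map (true ∷_) As) ++ map f (map (false ∷_) As))
    ≡⟨ sum-++ (map f (map (true ∷_) As)) _ ⟩
  sum (map f (map (true ∷_) As)) + sum (map f (map (false ∷_) As))
    ≡⟨ cong₂ (λ xs ys → sum xs + sum ys) (map-∘ As) (map-∘ As) ⟨
  ∑⊆ G (f ∘ (true ∷_)) + ∑⊆ G (f ∘ (false ∷_)) ∎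
  where As = edgeSets G

-- Vanishing of integer-valued functions on the vertices.

IsZero : (Fin n → ℤ) → Set
IsZero x = ∀ v → x v ≡ 0ℤ

isZero? : (x : Fin n → ℤ) → Dec (IsZero x)
isZero? x = all? (λ v → x v ℤ.≟ 0ℤ)

IsZero-cong : {x y : Fin n → ℤ} → (∀ v → x v ≡ y v) → IsZero x ⇔ IsZero y
IsZero-cong x≗y = mk⇔ (λ x≗0 v → trans (sym (x≗y v)) (x≗0 v)) (λ y≗0 v → trans (x≗y v) (y≗0 v))

i+i≡0⇒i≡0 : ∀ i → i ℤ.+ i ≡ 0ℤ → i ≡ 0ℤ
i+i≡0⇒i≡0 i i+i≡0 with ℤ.i*j≡0⇒i≡0∨j≡0 (+ 2) (trans (double i) i+i≡0)
  where
  double : ∀ j → + 2 ℤ.* j ≡ j ℤ.+ j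
  double = ℤ-Solver.solve-∀
-- The other alternative would be `+ 2 ≡ 0ℤ`, which is empty by unification.
... | inj₂ i≡0 = i≡0

module _ {x y p q : Fin n → ℤ}
  (x≗p+q : ∀ v → x v ≡ p v ℤ.+ q v) (y≗p-q : ∀ v → y v ≡ p v ℤ.- q v) where

  -- Adding the two relations gives 2p = x + y, subtracting them gives 2q = x - y, and the integers
  -- have no 2-torsion.
  isZero-sum-difference : (IsZero x × IsZero y) ⇔ (IsZero p × IsZero q)
  isZero-sum-difference = mk⇔ to from
    where
    2p : ∀ i j → i ℤ.+ i ≡ (i ℤ.+ j) ℤ.+ (i ℤ.- j)
    2p = ℤ-Solver.solve-∀
    2q : ∀ i j → j ℤ.+ j ≡ (i ℤ.+ j) ℤ.- (i ℤ.- j)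
    2q = ℤ-Solver.solve-∀
    to : IsZero x × IsZero y → IsZero p × IsZero q
    to (x≗0 , y≗0) =
      (λ v → i+i≡0⇒i≡0 (p v) (trans (2p (p v) (q v)) (cong₂ ℤ._+_ (p+q≡0 v) (p-q≡0 v)))) ,
      (λ v → i+i≡0⇒i≡0 (q v) (trans (2q (p v) (q v)) (cong₂ ℤ._-_ (p+q≡0 v) (p-q≡0 v))))
      where
      p+q≡0 : ∀ v → p v ℤ.+ q v ≡ 0ℤ
      p+q≡0 v = trans (sym (x≗p+q v)) (x≗0 v)
      p-q≡0 : ∀ v → p v ℤ.- q v ≡ 0ℤ
      p-q≡0 v = trans (sym (y≗p-q v)) (y≗0 v)
    from : IsZero p × IsZero q → IsZero x × IsZero y
    from (p≗0 , q≗0) =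
      (λ v → trans (x≗p+q v) (cong₂ ℤ._+_ (p≗0 v) (q≗0 v))) ,
      (λ v → trans (y≗p-q v) (cong₂ ℤ._-_ (p≗0 v) (q≗0 v)))

-- Balanced signings for an arbitrary edge weight.

module Signings {n : ℕ} (w : Edge n → Fin n → ℤ) where

  -- The number of signings s of the edges of G with x + ∑ s(e) w(e) = 0.
  balancings : Graph n → (Fin n → ℤ) → ℕ
  balancings []      x = indicator (isZero? x)
  balancings (e ∷ G) x =
    balancings G (λ v → x v ℤ.+ w e v) + balancings G (λ v → x v ℤ.- w e v)

  -- Two copies of the edge e carry four pairs of signs: equal signs shift p and
  -- opposite signs shift q.
  balancings-* : (G : Graph n) {x y p q : Fin n → ℤ} →
    (∀ v → x v ≡ p v ℤ.+ q v) → (∀ v → y v ≡ p v ℤ.- q v) →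
    balancings G x * balancings G y ≡ ∑⊆ G (λ A → balancings (G ↾ A) p * balancings (G ↾ ∁ A) q)
  -- All signs are chosen: `x` and `y` have accumulated the sums of the two signings, `p` and `q`
  -- the parts of the first sum on `A` and on its complement.
  balancings-* [] {x} {y} {p} {q} x≗ y≗ = begin
    indicator (isZero? x) * indicator (isZero? y)
      ≡⟨ indicator-× (isZero? x) (isZero? y) ⟩
    indicator (isZero? x ×-dec isZero? y)
      ≡⟨ indicator-cong (isZero-sum-difference x≗ y≗) (isZero? x ×-dec isZero? y) (isZero? p ×-dec isZero? q) ⟩
    indicator (isZero? p ×-dec isZero? q)
      ≡⟨ indicator-× (isZero? p) (isZero? q) ⟨
    indicator (isZero? p) * indicator (isZero? q)
      ≡⟨ +-identityʳ _ ⟨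
    indicator (isZero? p) * indicator (isZero? q) + 0 ∎
  balancings-* (e ∷ G) {x} {y} {p} {q} x≗ y≗ = begin
    (N G x₊ + N G x₋) * (N G y₊ + N G y₋)
      ≡⟨ expand (N G x₊) (N G x₋) (N G y₊) (N G y₋) ⟩
    (N G x₊ * N G y₊ + N G x₋ * N G y₋) + (N G x₊ * N G y₋ + N G x₋ * N G y₊)
      -- The induction hypothesis is used for the sign pairs (+,+), (-,-), (+,-), (-,+) in this
      -- order. The sign that shifts `p` or `q` is always the one that shifts `x`.
      ≡⟨ cong₂ _+_
           (cong₂ _+_
             (balancings-* G (λ v → move (x≗ v) (eq₁ (p v) (q v) (w e v))) (λ v → move (y≗ v) (eq₂ (p v) (q v) (w e v))))
             (balancings-* G (λ v → move′ (x≗ v) (eq₃ (p v) (q v) (w e v))) (λ v → move′ (y≗ v) (eq₄ (p v) (q v) (w e v)))))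
           (cong₂ _+_
             (balancings-* G (λ v → move (x≗ v) (eq₅ (p v) (q v) (w e v))) (λ v → move′ (y≗ v) (eq₆ (p v) (q v) (w e v))))
             (balancings-* G (λ v → move′ (x≗ v) (eq₇ (p v) (q v) (w e v))) (λ v → move (y≗ v) (eq₈ (p v) (q v) (w e v))))) ⟩
    (S p₊ q + S p₋ q) + (S p q₊ + S p q₋)
      ≡⟨ cong₂ _+_ (sum-map-+ (T p₊ q) (T p₋ q) (edgeSets G)) (sum-map-+ (T p q₊) (T p q₋) (edgeSets G)) ⟨
    ∑⊆ G (λ A → T p₊ q A + T p₋ q A) + ∑⊆ G (λ A → T p q₊ A + T p q₋ A)
      ≡⟨ cong₂ _+_
           (sum-map-cong (λ A → *-distribʳ-+ (N (G ↾ ∁ A) q) (N (G ↾ A) p₊) (N (G ↾ A) p₋)) (edgeSets G))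
           (sum-map-cong (λ A → *-distribˡ-+ (N (G ↾ A) p) (N (G ↾ ∁ A) q₊) (N (G ↾ ∁ A) q₋)) (edgeSets G)) ⟨
    ∑⊆ G (λ A → (N (G ↾ A) p₊ + N (G ↾ A) p₋) * N (G ↾ ∁ A) q) +
    ∑⊆ G (λ A → N (G ↾ A) p * (N (G ↾ ∁ A) q₊ + N (G ↾ ∁ A) q₋))
      -- By computation, `e` survives in the restriction to `A` in the first sum and in the
      -- restriction to `∁ A` in the second.
      ≡⟨ ∑⊆-∷ e G (λ A → N ((e ∷ G) ↾ A) p * N ((e ∷ G) ↾ ∁ A) q) ⟨
    ∑⊆ (e ∷ G) (λ A → N ((e ∷ G) ↾ A) p * N ((e ∷ G) ↾ ∁ A) q) ∎
    where
    N = balancings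
    x₊ x₋ y₊ y₋ p₊ p₋ q₊ q₋ : Fin n → ℤ
    x₊ v = x v ℤ.+ w e v
    x₋ v = x v ℤ.- w e v
    y₊ v = y v ℤ.+ w e v
    y₋ v = y v ℤ.- w e v
    p₊ v = p v ℤ.+ w e v
    p₋ v = p v ℤ.- w e v
    q₊ v = q v ℤ.+ w e v
    q₋ v = q v ℤ.- w e v
    T : (Fin n → ℤ) → (Fin n → ℤ) → EdgeSet G → ℕ
    T r s A = N (G ↾ A) r * N (G ↾ ∁ A) s
    S : (Fin n → ℤ) → (Fin n → ℤ) → ℕ
    S r s = ∑⊆ G (T r s)
    expand : ∀ a b c d → (a + b) * (c + d) ≡ (a * c + b * d) + (a * d + b * c)
    expand = ℕ-Solver.solve-∀
    move : ∀ {i j k l} → i ≡ j → j ℤ.+ k ≡ l → i ℤ.+ k ≡ l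
    move refl eq = eq
    move′ : ∀ {i j k l} → i ≡ j → j ℤ.- k ≡ l → i ℤ.- k ≡ l
    move′ refl eq = eq
    eq₁ : ∀ i j k → (i ℤ.+ j) ℤ.+ k ≡ (i ℤ.+ k) ℤ.+ j
    eq₁ = ℤ-Solver.solve-∀
    eq₂ : ∀ i j k → (i ℤ.- j) ℤ.+ k ≡ (i ℤ.+ k) ℤ.- j
    eq₂ = ℤ-Solver.solve-∀
    eq₃ : ∀ i j k → (i ℤ.+ j) ℤ.- k ≡ (i ℤ.- k) ℤ.+ j
    eq₃ = ℤ-Solver.solve-∀
    eq₄ : ∀ i j k → (i ℤ.- j) ℤ.- k ≡ (i ℤ.- k) ℤ.- j
    eq₄ = ℤ-Solver.solve-∀
    eq₅ : ∀ i j k → (i ℤ.+ j) ℤ.+ k ≡ i ℤ.+ (j ℤ.+ k)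
    eq₅ = ℤ-Solver.solve-∀
    eq₆ : ∀ i j k → (i ℤ.- j) ℤ.- k ≡ i ℤ.- (j ℤ.+ k)
    eq₆ = ℤ-Solver.solve-∀
    eq₇ : ∀ i j k → (i ℤ.+ j) ℤ.- k ≡ i ℤ.+ (j ℤ.- k)
    eq₇ = ℤ-Solver.solve-∀
    eq₈ : ∀ i j k → (i ℤ.- j) ℤ.+ k ≡ i ℤ.- (j ℤ.- k)
    eq₈ = ℤ-Solver.solve-∀

  -- All four accumulators start at zero, and 0 = 0 + 0 and 0 = 0 - 0 hold by computation.
  balancings-^2 : (G : Graph n) →
    balancings G (λ _ → 0ℤ) ^ 2 ≡
    ∑⊆ G (λ A → balancings (G ↾ A) (λ _ → 0ℤ) * balancings (G ↾ ∁ A) (λ _ → 0ℤ))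
  balancings-^2 G = trans
    (cong (balancings G (λ _ → 0ℤ) *_) (*-identityʳ _))
    (balancings-* G (λ _ → refl) (λ _ → refl))

  -- Common interface for orientations and edge subsets: both are built by one binary choice per
  -- edge, and the choice moves an additive imbalance by plus or minus the weight of that edge.
  module Configurations
    (Config : Graph n → Set)
    (configs : ∀ G → List (Config G))
    (∅ : Config [])
    (plus minus : ∀ e {G} → Config G → Config (e ∷ G))
    (configs-[] : configs [] ≡ ∅ ∷ [])
    (configs-∷ : ∀ e G → configs (e ∷ G) ≡ map (plus e) (configs G) ++ map (minus e) (configs G))
    (imbalance : ∀ G → Config G → Fin n → ℤ)
    (imbalance-∅ : ∀ v → imbalance [] ∅ v ≡ 0ℤ)
    (imbalance-plus : ∀ e G c v → imbalance (e ∷ G) (plus e c) v ≡ w e v ℤ.+ imbalance G c v)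
    (imbalance-minus : ∀ e G c v → imbalance (e ∷ G) (minus e c) v ≡ ℤ.- w e v ℤ.+ imbalance G c v)
    where

    -- Induction on the edges, with `x` holding the signed weight of those already decided. The
    -- predicate is arbitrary up to equivalence because the recursion replaces it by its composites
    -- with `plus e` and `minus e`.
    count-balanced : ∀ G x {P : Pred (Config G) 0ℓ} (P? : Decidable P) →
      (∀ c → P c ⇔ IsZero (λ v → x v ℤ.+ imbalance G c v)) →
      length (filter P? (configs G)) ≡ balancings G x
    count-balanced [] x P? P⇔ = begin
      length (filter P? (configs []))  ≡⟨ cong (length ∘ filter P?) configs-[] ⟩
      length (filter P? (∅ ∷ []))      ≡⟨ length-filter-∷ P? ∅ [] ⟩
      indicator (P? ∅) + 0             ≡⟨ +-identityʳ _ ⟩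
      indicator (P? ∅)                 ≡⟨ indicator-cong (IsZero-cong x+∅≗x ⇔-∘ P⇔ ∅) (P? ∅) (isZero? x) ⟩
      indicator (isZero? x)            ∎
      where
      x+∅≗x : ∀ v → x v ℤ.+ imbalance [] ∅ v ≡ x v
      x+∅≗x v = trans (cong (λ i → x v ℤ.+ i) (imbalance-∅ v)) (ℤ.+-identityʳ (x v))
    count-balanced (e ∷ G) x P? P⇔ = begin
      length (filter P? (configs (e ∷ G)))
        ≡⟨ cong (length ∘ filter P?) (configs-∷ e G) ⟩
      length (filter P? (map (plus e) cs ++ map (minus e) cs))
        ≡⟨ cong length (filter-++ P? (map (plus e) cs) _) ⟩
      length (filter P? (map (plus e) cs) ++ filter P? (map (minus e) cs))
        ≡⟨ length-++ (filter P? (map (plus e) cs)) ⟩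
      length (filter P? (map (plus e) cs)) + length (filter P? (map (minus e) cs))
        ≡⟨ cong₂ _+_ (length-filter-map P? (plus e) cs) (length-filter-map P? (minus e) cs) ⟩
      length (filter (P? ∘ plus e) cs) + length (filter (P? ∘ minus e) cs)
        ≡⟨ cong₂ _+_
             (count-balanced G _ (P? ∘ plus e)
               (λ c → IsZero-cong (λ v → shift (x v) (w e v) (imbalance G c v) (imbalance-plus e G c v)) ⇔-∘ P⇔ (plus e c)))
             -- Integer subtraction unfolds to adding the negative, so the shift by `ℤ.- w e v`
             -- matches the second summand of `balancings`.
             (count-balanced G _ (P? ∘ minus e)
               (λ c → IsZero-cong (λ v → shift (x v) (ℤ.- w e v) (imbalance G c v) (imbalance-minus e G c v)) ⇔-∘ P⇔ (minus e c))) ⟩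
      balancings (e ∷ G) x ∎
      where
      cs = configs G
      shift : ∀ i k l {j} → j ≡ k ℤ.+ l → i ℤ.+ j ≡ (i ℤ.+ k) ℤ.+ l
      shift i k l refl = sym (ℤ.+-assoc i k l)

    count-balanced₀ : ∀ G {P : Pred (Config G) 0ℓ} (P? : Decidable P) →
      (∀ c → P c ⇔ IsZero (imbalance G c)) →
      length (filter P? (configs G)) ≡ balancings G (λ _ → 0ℤ)
    count-balanced₀ G P? P⇔ = count-balanced G _ P?
      (λ c → IsZero-cong (λ v → sym (ℤ.+-identityˡ (imbalance G c v))) ⇔-∘ P⇔ c)


neg-difference : ∀ i j → ℤ.- (i ℤ.- j) ≡ j ℤ.- i
neg-difference = ℤ-Solver.solve-∀

-- Being Eulerian and being a half graph are both equalities of naturals at each vertex; as integer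
-- differences they become additive over the edges.
isZero-difference : {f g : Fin n → ℕ} → (∀ v → f v ≡ g v) ⇔ IsZero (λ v → + f v ℤ.- + g v)
isZero-difference = mk⇔
  (λ f≗g v → ℤ.i≡j⇒i-j≡0 (cong +_ (f≗g v)))
  (λ f-g≗0 v → ℤ.+-injective (ℤ.i-j≡0⇒i≡j _ _ (f-g≗0 v)))

-- Eulerian orientations as balanced signings.

module Orientations {n : ℕ} where

  at : Fin n → Fin n → ℕ
  at u v = indicator (v ≟ u)

  -- The column of `e` in the signed incidence matrix. The sign + stands for the arc from `end₁ e`
  -- to `end₂ e`.
  weight : Edge n → Fin n → ℤ
  weight e v = + at (end₂ e) v ℤ.- + at (end₁ e) v

  open Signings weight public

  excess : List (Arc n) → Fin n → ℤ
  excess o v = + inDegree o v ℤ.- + outDegree o v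

  excess-∷ : ∀ a o v → excess (a ∷ o) v ≡ (+ at (head a) v ℤ.- + at (tail a) v) ℤ.+ excess o v
  excess-∷ a o v = begin
    + inDegree (a ∷ o) v ℤ.- + outDegree (a ∷ o) v
      ≡⟨ cong₂ (λ i j → + i ℤ.- + j)
           (length-filter-∷ (λ b → v ≟ head b) a o) (length-filter-∷ (λ b → v ≟ tail b) a o) ⟩
    + (at (head a) v + inDegree o v) ℤ.- + (at (tail a) v + outDegree o v)
      ≡⟨ cong₂ ℤ._-_ (ℤ.pos-+ (at (head a) v) _) (ℤ.pos-+ (at (tail a) v) _) ⟩
    (+ at (head a) v ℤ.+ + inDegree o v) ℤ.- (+ at (tail a) v ℤ.+ + outDegree o v)
      ≡⟨ regroup (+ at (head a) v) (+ inDegree o v) (+ at (tail a) v) (+ outDegree o v) ⟩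
    (+ at (head a) v ℤ.- + at (tail a) v) ℤ.+ excess o v ∎
    where
    regroup : ∀ i j k l → (i ℤ.+ j) ℤ.- (k ℤ.+ l) ≡ (i ℤ.- k) ℤ.+ (j ℤ.- l)
    regroup = ℤ-Solver.solve-∀

  open Configurations (λ _ → List (Arc n)) orientations []
    (λ e → (end₁ e , end₂ e) ∷_) (λ e → (end₂ e , end₁ e) ∷_)
    refl (λ e G → cartesianProductWith-pair _∷_ (end₁ e , end₂ e) (end₂ e , end₁ e) (orientations G))
    (λ _ → excess) (λ _ → refl)
    (λ e _ → excess-∷ (end₁ e , end₂ e))
    -- Reversing an arc swaps head and tail, which negates its contribution.
    (λ e _ o v → trans (excess-∷ (end₂ e , end₁ e) o v)
      (cong (ℤ._+ excess o v) (sym (neg-difference (+ at (end₂ e) v) (+ at (end₁ e) v)))))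

  ε≡balancings : (G : Graph n) → ε G ≡ balancings G (λ _ → 0ℤ)
  ε≡balancings G = count-balanced₀ G isEulerianOrientation? (λ _ → isZero-difference)

-- Half graphs as balanced signings.

module HalfGraphs {n : ℕ} where

  -- The column of `e` in the unsigned incidence matrix.
  weight : Edge n → Fin n → ℤ
  weight e v = + indicator (incident? v e)

  open Signings weight public

  -- This equals the degree inside `S` minus the degree outside `S`, so edges in `S` carry the sign
  -- + and the others the sign -.
  surplus : (G : Graph n) → EdgeSet G → Fin n → ℤ
  surplus G S v = + (2 * degree (G ↾ S) v) ℤ.- + degree G v

  degree-∷ : ∀ e (G : Graph n) v → degree (e ∷ G) v ≡ indicator (incident? v e) + degree G v
  degree-∷ e G v = length-filter-∷ (incident? v) e G

  -- A chosen edge with incidence k at `v` adds 2k to the doubled degree and k to the total degree,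
  -- a net gain of k.
  surplus-true : ∀ e G S v → surplus (e ∷ G) (true ∷ S) v ≡ weight e v ℤ.+ surplus G S v
  surplus-true e G S v = begin
    + (2 * degree (e ∷ G ↾ S) v) ℤ.- + degree (e ∷ G) v
      ≡⟨ cong₂ (λ i j → + (2 * i) ℤ.- + j) (degree-∷ e (G ↾ S) v) (degree-∷ e G v) ⟩
    + (2 * (k + s)) ℤ.- + (k + d)
      ≡⟨ cong₂ ℤ._-_ (trans (ℤ.pos-* 2 (k + s)) (cong (λ i → + 2 ℤ.* i) (ℤ.pos-+ k s))) (ℤ.pos-+ k d) ⟩
    + 2 ℤ.* (+ k ℤ.+ + s) ℤ.- (+ k ℤ.+ + d)
      ≡⟨ regroup (+ k) (+ s) (+ d) ⟩
    + k ℤ.+ (+ 2 ℤ.* + s ℤ.- + d)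
      ≡⟨ cong (λ i → + k ℤ.+ (i ℤ.- + d)) (ℤ.pos-* 2 s) ⟨
    weight e v ℤ.+ surplus G S v ∎
    where
    k = indicator (incident? v e)
    s = degree (G ↾ S) v
    d = degree G v
    regroup : ∀ i j l → + 2 ℤ.* (i ℤ.+ j) ℤ.- (i ℤ.+ l) ≡ i ℤ.+ (+ 2 ℤ.* j ℤ.- l)
    regroup = ℤ-Solver.solve-∀

  surplus-false : ∀ e G S v → surplus (e ∷ G) (false ∷ S) v ≡ ℤ.- weight e v ℤ.+ surplus G S v
  surplus-false e G S v = begin
    + t ℤ.- + degree (e ∷ G) v      ≡⟨ cong (λ j → + t ℤ.- + j) (degree-∷ e G v) ⟩
    + t ℤ.- + (k + d)               ≡⟨ cong (λ j → + t ℤ.- j) (ℤ.pos-+ k d) ⟩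
    + t ℤ.- (+ k ℤ.+ + d)           ≡⟨ regroup (+ t) (+ k) (+ d) ⟩
    ℤ.- + k ℤ.+ (+ t ℤ.- + d)       ∎
    where
    k = indicator (incident? v e)
    t = 2 * degree (G ↾ S) v
    d = degree G v
    regroup : ∀ i j l → i ℤ.- (j ℤ.+ l) ≡ ℤ.- j ℤ.+ (i ℤ.- l)
    regroup = ℤ-Solver.solve-∀

  open Configurations EdgeSet edgeSets []
    (λ _ → true ∷_) (λ _ → false ∷_)
    refl (λ e G → cartesianProductWith-pair _∷_ true false (edgeSets G))
    surplus (λ _ → refl) surplus-true surplus-false

  h≡balancings : (G : Graph n) → h G ≡ balancings G (λ _ → 0ℤ)
  h≡balancings G = count-balanced₀ G (isHalfGraph? G) (λ _ → isZero-difference)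

-- The agreement of `f` and `g` is asked of every graph because the sum evaluates them at subgraphs
-- of `G`.
^2-transfer : (G : Graph n) {f g : Graph n → ℕ} → (∀ H → f H ≡ g H) →
  g G ^ 2 ≡ ∑⊆ G (λ A → g (G ↾ A) * g (G ↾ ∁ A)) →
  f G ^ 2 ≡ ∑⊆ G (λ A → f (G ↾ A) * f (G ↾ ∁ A))
^2-transfer G {f} {g} f≗g eq = begin
  f G ^ 2                              ≡⟨ cong (_^ 2) (f≗g G) ⟩
  g G ^ 2                              ≡⟨ eq ⟩
  ∑⊆ G (λ A → g (G ↾ A) * g (G ↾ ∁ A)) ≡⟨ sum-map-cong (λ A → cong₂ _*_ (f≗g (G ↾ A)) (f≗g (G ↾ ∁ A))) (edgeSets G) ⟨
  ∑⊆ G (λ A → f (G ↾ A) * f (G ↾ ∁ A)) ∎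

theorem1p1 : (n : ℕ) (G : Graph n) → IsEulerianGraph G →
    (ε G ^ 2 ≡ ∑⊆ G (λ A → ε (G ↾ A) * ε (G ↾ ∁ A))) ×
    (h G ^ 2 ≡ ∑⊆ G (λ A → h (G ↾ A) * h (G ↾ ∁ A)))
theorem1p1 n G _ =
  ^2-transfer G Orientations.ε≡balancings (Orientations.balancings-^2 G) ,
  ^2-transfer G HalfGraphs.h≡balancings (HalfGraphs.balancings-^2 G)
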